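{- Let $\mathcal{A}$ be a set of quantifier-free axioms in $\mathcal{L}$ and let $\mathcal{B}$ be a theory in $\mathcal{L}$. (i) Let $\Phi$ be a class of bounded formulas containing all quantifier-free formulas and closed under boolean operations, substitution and subformulas, and let $k\ge 0$. If $\Gamma(\vec{x})\rhd_d^{(\Pi_k(\Phi),\mathcal{B})}\Delta(\vec{x})$ and $\mathcal{B}\subseteq\mathfrak{B}(\mathbb{T}_{all},\Pi_k(\Phi),\mathcal{A})$, then $\mathfrak{B}(\mathbb{T}_{all},\Pi_k(\Phi),\mathcal{A})\vdash\Gamma(\vec{x})\Rightarrow\Delta(\vec{x})$. (ii) Let $\mathbb{T}$ be an $\mathcal{A}$-term ideal and $\Pi$ a $\pi$-class of (bounded) formulas. If $\Gamma(\vec{x})\rhd_n^{(\mathbb{T},\Pi,\mathcal{B})}\Delta(\vec{x})$ and $\mathcal{B}\subseteq\mathfrak{B}(\mathbb{T},\Pi,\mathcal{A})$, then $\mathfrak{B}(\mathbb{T},\Pi,\mathcal{A})\vdash\Gamma(\vec{x})\Rightarrow\Delta(\vec{x})$.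
   Context: **Language and base theory.** $\mathcal{L}$ is a first-order language of arithmetic extending $\{0,1,+,-,\cdot,\lfloor\frac{\cdot}{\cdot}\rfloor,\le\}$. $\mathcal{R}$ is the theory of commutative discrete ordered semirings (commutative ring axioms without additive inverses, plus: $\le$ is a total discrete order with $<$ compatible with addition and with multiplication by non-zero elements) together with $(x\ge y\to (x-y)+y=x)\wedge(x<y\to x-y=0)$ and $((y+1)\cdot\lfloor\frac{x}{y}\rfloor\le x)\wedge(x-(y+1)\cdot\lfloor\frac{x}{y}\rfloor<y+1)$ (so $\lfloor\frac{x}{y}\rfloor$ really denotes $\lfloor x/(y+1)\rfloor$). All axiom sets $\mathcal A$ and theories $\mathcal B$ are assumed to contain $\mathcal R$. **Term ideals.** A class $\mathbb{T}$ of terms is a $\mathcal{B}$-term set if, provably in $\mathcal{B}$, it is closed under the basic operations of the language of $\mathcal{R}$ and under substitution: if $t(\vec x,y)\in\mathbb{T}$ and $s$ is any term, $t(\vec x,s)$ is $\mathcal{B}$-provably equal to a term in $\mathbb{T}$. It is a $\mathcal{B}$-term ideal if moreover there is $X\subseteq\mathbb{T}$ such that each $t\in\mathbb{T}$ has $s\in X$ with $\mathcal{B}\vdash t(\vec x)\le s(\vec x)$, and each $r\in X$ is $\mathcal{B}$-provably monotone ($\vec x\le\vec y\to r(\vec x)\le r(\vec y)$). $\mathbb{T}_{all}$ is the class of all terms; whenever $\mathfrak B(\mathbb T_{all},\cdot,\mathcal A)$ is used, $\mathbb T_{all}$ is assumed to be an $\mathcal A$-term ideal. **Bounded arithmetic.**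 For a set $\mathcal{A}$ of quantifier-free axioms, an $\mathcal{A}$-term ideal $\mathbb{T}$, and a class $\Psi$ of bounded formulas closed under substitution and subformulas, $\mathfrak{B}(\mathbb{T},\Psi,\mathcal{A})$ is the first-order theory in $\mathcal{L}$ with axioms $\mathcal{A}$ and $A(0)\wedge\forall x(A(x)\to A(x+1))\to\forall x\,A(t(x))$ for $A\in\Psi$, $t\in\mathbb{T}$. A theory proves a sequent $\Gamma\Rightarrow\Delta$ iff it proves $\bigwedge\Gamma\to\bigvee\Delta$. **$\pi$-class.** An $\mathcal{R}$-conjunction (disjunction, negation, bounded quantification) of formulas is a formula $\mathcal{R}$-provably equivalent to the conjunction (etc.). A class $\Pi$ of formulas is a $\pi$-class if it contains all quantifier-free formulas, is closed under substitution, subformulas, an $\mathcal{R}$-conjunction, an $\mathcal{R}$-disjunction and an $\mathcal{R}$-bounded universal quantification, and if $\exists y\le t\,B(y)\in\Pi$ then $B$ has an $\mathcal{R}$-negation in $\Pi$ and $\forall y\le t\,\neg B(y)$ has an $\mathcal{R}$-negation in $\Pi$. **Hierarchy.** $\Pi_0(\Phi)=\Sigma_0(\Phi)=\Phi$; $\Sigma_{k+1}(\Phi)$ consists of formulas with a block of bounded existential quantifiers in front of a $\Pi_k(\Phi)$ formula, and $\Pi_{k+1}(\Phi)$ of formulas with a block of bounded universal quantifiers in front of a $\Sigma_k(\Phi)$ formula. Boolean combinations such as $\bigwedge\Gamma$, $\bigvee\Delta$ are replaced by $\mathcal{R}$-equivalent prenex formulas in the relevant class. **Deterministic reductions.** For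 $A,B$ both in $\Pi_k(\Phi)$ or both in $\Sigma_k(\Phi)$ and a sequence of terms $F=(F_i)_{i=1}^k$, define $A\le_d^{F,k}B$ by recursion on $k$. For $k=0$: $F$ is empty and $\mathcal{B}\vdash A\to B$. If $A=\forall\vec u\le\vec p(\vec x)\,C(\vec x,\vec u)$, $B=\forall\vec v\le\vec q(\vec x)\,D(\vec x,\vec v)$: $A\le_d^{F,k+1}B$ iff $\mathcal{B}\vdash\vec v\le\vec q(\vec x)\to F_{k+1}(\vec x,\vec v)\le\vec p(\vec x)$ and $\big(F_{k+1}(\vec x,\vec v)\le\vec p(\vec x)\to C(\vec x,F_{k+1}(\vec x,\vec v))\big)\le_d^{\hat F,k}\big(\vec v\le\vec q(\vec x)\to D(\vec x,\vec v)\big)$ with $\hat F=(F_i)_{i=1}^{k}$. If $A=\exists\vec u\le\vec p(\vec x)\,C$, $B=\exists\vec v\le\vec q(\vec x)\,D$: iff $\mathcal{B}\vdash\vec u\le\vec p(\vec x)\to F_{k+1}(\vec x,\vec u)\le\vec q(\vec x)$ and $\big(\vec u\le\vec p(\vec x)\wedge C(\vec x,\vec u)\big)\le_d^{\hat F,k}\big(F_{k+1}(\vec x,\vec u)\le\vec q(\vec x)\wedge D(\vec x,F_{k+1}(\vec x,\vec u))\big)$. $A\equiv_d^{(E_0,E_1)}B$ means $A\le_d^{E_0}B$ and $B\le_d^{E_1}A$. **Deterministic flow.** For $A,B\in\Pi_k(\Phi)$, $A\rhd_d^{(\Pi_k(\Phi),\mathcal{B})}B$ means there are a term $t(\vec x)$,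 a formula $H(u,\vec x)\in\Pi_k(\Phi)$ and sequences of terms $E_0,E_1,G_0,G_1,F(u)$ such that, provably in $\mathcal{B}$: $H(0,\vec x)\equiv_d^{(E_0,E_1)}A(\vec x)$; $H(t(\vec x),\vec x)\equiv_d^{(G_0,G_1)}B(\vec x)$; and for all $u<t(\vec x)$, $H(u,\vec x)\le_d^{F(u)}H(u+1,\vec x)$. **Non-deterministic flow.** For $A,B\in\Pi$, $A\rhd_n^{(\mathbb{T},\Pi,\mathcal{B})}B$ means there are $t(\vec x)\in\mathbb{T}$ and $H(u,\vec x)\in\Pi$ with $\mathcal{B}\vdash H(0,\vec x)\leftrightarrow A(\vec x)$, $\mathcal{B}\vdash H(t(\vec x),\vec x)\leftrightarrow B(\vec x)$ and $\mathcal{B}\vdash\forall u<t(\vec x)\,(H(u,\vec x)\to H(u+1,\vec x))$. For finite multisets $\Gamma,\Delta$ of formulas of the class in question, $\Gamma\rhd\Delta$ means $\bigwedge\Gamma\rhd\bigvee\Delta$. -}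

module Defs where

open import Level using (0ℓ)
open import Data.Nat.Base using (ℕ; zero; suc; _+_)
open import Data.Fin.Base using (Fin; zero; suc; _↑ˡ_; _↑ʳ_)
open import Data.Fin.Patterns using (0F; 1F; 2F)
open import Data.List.Base using (List; []; _∷_; foldr; map; tabulate)
open import Data.List.Membership.Propositional using () renaming (_∈_ to _∈ˡ_)
open import Data.Vec.Base using (Vec; []; _∷_)
open import Data.Vec.Relation.Unary.All using (All)
open import Data.Vec.Functional using (Vector) renaming (_∷_ to _∷ᵛ_; _++_ to _++ᵛ_)
open import Data.Product.Base using (∃-syntax; _×_)
open import Function.Base using (_∘_)
open import Relation.Unary using (Pred; _∈_; _⊆_; U)

infix  12 _[_]ᵗ _[_]ˢ _[_]
infixl 11 _⊗_ _⊘_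
infixl 10 _⊕_ _⊖_
infix  9 _≐_ _≼_ _≺_
infixr 8 _∧_
infixr 7 _∨_
infixr 6 _⇒_
infix  5 _⇔_
infix  1 _∣_⊢_ _⊢_ _⊑_

-- Terms and formulas are well scoped: 'Formula L n' has its free
-- variables among x₀ , … , xₙ₋₁, and a quantifier binds x₀.

data ArithFunc : ℕ → Set where
  zeroᶠ oneᶠ                  : ArithFunc 0
  plusᶠ minusᶠ timesᶠ divideᶠ : ArithFunc 2

data ArithRel : ℕ → Set where
  leqʳ : ArithRel 2

-- A language extending that of arithmetic is given by the symbols it adds.
record Language : Set₁ where
  field
    ExtraFunc : ℕ → Set
    ExtraRel  : ℕ → Set

open Language

data Func (L : Language) (k : ℕ) : Set where
  arith : ArithFunc k → Func L k
  extra : ExtraFunc L k → Func L k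

data Rel (L : Language) (k : ℕ) : Set where
  arith : ArithRel k → Rel L k
  extra : ExtraRel L k → Rel L k

data Term (L : Language) (n : ℕ) : Set where
  var : Fin n → Term L n
  fun : {k : ℕ} → Func L k → Vec (Term L n) k → Term L n

data Formula (L : Language) : ℕ → Set where
  _≐_     : {n : ℕ} → Term L n → Term L n → Formula L n
  rel     : {n k : ℕ} → Rel L k → Vec (Term L n) k → Formula L n
  ⊥′      : {n : ℕ} → Formula L n
  _∧_ _∨_ : {n : ℕ} → Formula L n → Formula L n → Formula L n
  _⇒_     : {n : ℕ} → Formula L n → Formula L n → Formula L n
  ∀′ ∃′   : {n : ℕ} → Formula L (suc n) → Formula L n

private
  variable
    L : Language
    a b k l m n : ℕ

⊤′ : Formula L n
⊤′ = ⊥′ ⇒ ⊥′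

¬′_ : Formula L n → Formula L n
¬′ φ = φ ⇒ ⊥′

_⇔_ : Formula L n → Formula L n → Formula L n
φ ⇔ ψ = (φ ⇒ ψ) ∧ (ψ ⇒ φ)

⋀ ⋁ : List (Formula L n) → Formula L n
⋀ = foldr _∧_ ⊤′
⋁ = foldr _∨_ ⊥′

𝟘 𝟙 : Term L n
𝟘 = fun (arith zeroᶠ) []
𝟙 = fun (arith oneᶠ) []

-- s ⊘ t is the term ⌊s/t⌋ of the language; by the axioms of 𝓡 its
-- value is the quotient of s by t + 1.
_⊕_ _⊖_ _⊗_ _⊘_ : Term L n → Term L n → Term L n
s ⊕ t = fun (arith plusᶠ)   (s ∷ t ∷ [])
s ⊖ t = fun (arith minusᶠ)  (s ∷ t ∷ [])
s ⊗ t = fun (arith timesᶠ)  (s ∷ t ∷ [])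
s ⊘ t = fun (arith divideᶠ) (s ∷ t ∷ [])

_≼_ _≺_ : Term L n → Term L n → Formula L n
s ≼ t = rel (arith leqʳ) (s ∷ t ∷ [])
s ≺ t = s ≼ t ∧ ¬′ (s ≐ t)

Sub : Language → ℕ → ℕ → Set
Sub L m n = Vector (Term L n) m

_[_]ᵗ : Term L m → Sub L m n → Term L n
_[_]ˢ : Vec (Term L m) k → Sub L m n → Vec (Term L n) k

var i    [ σ ]ᵗ = σ i
fun f ts [ σ ]ᵗ = fun f (ts [ σ ]ˢ)

[]       [ σ ]ˢ = []
(t ∷ ts) [ σ ]ˢ = t [ σ ]ᵗ ∷ ts [ σ ]ˢ

wkᵗ : Term L n → Term L (suc n)
wkᵗ t = t [ var ∘ suc ]ᵗ

lift : Sub L m n → Sub L (suc m) (suc n)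
lift σ = var zero ∷ᵛ (wkᵗ ∘ σ)

_[_] : Formula L m → Sub L m n → Formula L n
(s ≐ t)  [ σ ] = s [ σ ]ᵗ ≐ t [ σ ]ᵗ
rel r ts [ σ ] = rel r (ts [ σ ]ˢ)
⊥′       [ σ ] = ⊥′
(φ ∧ ψ)  [ σ ] = φ [ σ ] ∧ ψ [ σ ]
(φ ∨ ψ)  [ σ ] = φ [ σ ] ∨ ψ [ σ ]
(φ ⇒ ψ)  [ σ ] = φ [ σ ] ⇒ ψ [ σ ]
∀′ φ     [ σ ] = ∀′ (φ [ lift σ ])
∃′ φ     [ σ ] = ∃′ (φ [ lift σ ])

wk : Formula L n → Formula L (suc n)
wk φ = φ [ var ∘ suc ]

wk* : (b : ℕ) → Formula L n → Formula L (b + n)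
wk* b φ = φ [ (λ i → var (b ↑ʳ i)) ]

-- φ(t), where the distinguished variable of φ is x₀
_⟨_⟩ : Formula L (suc n) → Term L n → Formula L n
φ ⟨ t ⟩ = φ [ t ∷ᵛ var ]

-- φ(t(x₀)): x₀ is replaced by a term in which x₀ may itself occur
_⟪_⟫ : Formula L (suc n) → Term L (suc n) → Formula L (suc n)
φ ⟪ t ⟫ = φ [ t ∷ᵛ (var ∘ suc) ]

-- Bounded quantifiers; weakening expresses that x₀ is not free in t.
∀≤ ∃≤ : Term L n → Formula L (suc n) → Formula L n
∀≤ t φ = ∀′ (var zero ≼ wkᵗ t ⇒ φ)
∃≤ t φ = ∃′ (var zero ≼ wkᵗ t ∧ φ)

TermClass : Language → Set₁
TermClass L = {n : ℕ} → Pred (Term L n) 0ℓ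

FormulaClass : Language → Set₁
FormulaClass L = {n : ℕ} → Pred (Formula L n) 0ℓ

-- A theory is a set of axioms, whose free variables are understood as
-- universally quantified.
Theory : Language → Set₁
Theory = FormulaClass

𝕋all : TermClass L
𝕋all = U

-- Classical logic with equality, in natural deduction style.  The rule
-- ax instantiates the implicitly quantified variables of an axiom.
data _∣_⊢_ (T : Theory L) : {n : ℕ} → List (Formula L n) → Formula L n → Set where
  ax  : {Γ : List (Formula L n)} {φ : Formula L m} →
        φ ∈ T → (σ : Sub L m n) → T ∣ Γ ⊢ φ [ σ ]
  hyp : {Γ : List (Formula L n)} {φ : Formula L n} → φ ∈ˡ Γ → T ∣ Γ ⊢ φ
  raa : {Γ : List (Formula L n)} {φ : Formula L n} →
        T ∣ (¬′ φ) ∷ Γ ⊢ ⊥′ → T ∣ Γ ⊢ φ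
  ∧I  : {Γ : List (Formula L n)} {φ ψ : Formula L n} →
        T ∣ Γ ⊢ φ → T ∣ Γ ⊢ ψ → T ∣ Γ ⊢ φ ∧ ψ
  ∧E₁ : {Γ : List (Formula L n)} {φ ψ : Formula L n} → T ∣ Γ ⊢ φ ∧ ψ → T ∣ Γ ⊢ φ
  ∧E₂ : {Γ : List (Formula L n)} {φ ψ : Formula L n} → T ∣ Γ ⊢ φ ∧ ψ → T ∣ Γ ⊢ ψ
  ∨I₁ : {Γ : List (Formula L n)} {φ ψ : Formula L n} → T ∣ Γ ⊢ φ → T ∣ Γ ⊢ φ ∨ ψ
  ∨I₂ : {Γ : List (Formula L n)} {φ ψ : Formula L n} → T ∣ Γ ⊢ ψ → T ∣ Γ ⊢ φ ∨ ψ
  ∨E  : {Γ : List (Formula L n)} {φ ψ χ : Formula L n} →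
        T ∣ Γ ⊢ φ ∨ ψ → T ∣ φ ∷ Γ ⊢ χ → T ∣ ψ ∷ Γ ⊢ χ → T ∣ Γ ⊢ χ
  ⇒I  : {Γ : List (Formula L n)} {φ ψ : Formula L n} →
        T ∣ φ ∷ Γ ⊢ ψ → T ∣ Γ ⊢ φ ⇒ ψ
  ⇒E  : {Γ : List (Formula L n)} {φ ψ : Formula L n} →
        T ∣ Γ ⊢ φ ⇒ ψ → T ∣ Γ ⊢ φ → T ∣ Γ ⊢ ψ
  ∀I  : {Γ : List (Formula L n)} {φ : Formula L (suc n)} →
        T ∣ map wk Γ ⊢ φ → T ∣ Γ ⊢ ∀′ φ
  ∀E  : {Γ : List (Formula L n)} {φ : Formula L (suc n)} →
        T ∣ Γ ⊢ ∀′ φ → (t : Term L n) → T ∣ Γ ⊢ φ ⟨ t ⟩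
  ∃I  : {Γ : List (Formula L n)} {φ : Formula L (suc n)} (t : Term L n) →
        T ∣ Γ ⊢ φ ⟨ t ⟩ → T ∣ Γ ⊢ ∃′ φ
  ∃E  : {Γ : List (Formula L n)} {φ : Formula L (suc n)} {χ : Formula L n} →
        T ∣ Γ ⊢ ∃′ φ → T ∣ φ ∷ map wk Γ ⊢ wk χ → T ∣ Γ ⊢ χ
  ≐I  : {Γ : List (Formula L n)} {t : Term L n} → T ∣ Γ ⊢ t ≐ t
  ≐E  : {Γ : List (Formula L n)} {s t : Term L n} (φ : Formula L (suc n)) →
        T ∣ Γ ⊢ s ≐ t → T ∣ Γ ⊢ φ ⟨ s ⟩ → T ∣ Γ ⊢ φ ⟨ t ⟩

_⊢_ : Theory L → Formula L n → Set
T ⊢ φ = T ∣ [] ⊢ φ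

-- Inclusion of theories, a theory being identified with the set of its
-- consequences: every axiom of S is a theorem of T.
_⊑_ : Theory L → Theory L → Set
_⊑_ {L} S T = {n : ℕ} {φ : Formula L n} → φ ∈ S → T ⊢ φ

private
  x : Term L (suc n)
  x = var 0F

  y : Term L (suc (suc n))
  y = var 1F

  z : Term L (suc (suc (suc n)))
  z = var 2F

-- The axioms of commutative discrete ordered semirings, ≼-discrete saying
-- that x + 1 is the immediate successor of x, followed by the axioms
-- defining subtraction and division.
data 𝓡 {L : Language} : {n : ℕ} → Formula L n → Set where
  ⊕-assoc     : 𝓡 {n = 3} ((x ⊕ y) ⊕ z ≐ x ⊕ (y ⊕ z))
  ⊕-comm      : 𝓡 {n = 2} (x ⊕ y ≐ y ⊕ x)
  ⊕-identity  : 𝓡 {n = 1} (x ⊕ 𝟘 ≐ x)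
  ⊗-assoc     : 𝓡 {n = 3} ((x ⊗ y) ⊗ z ≐ x ⊗ (y ⊗ z))
  ⊗-comm      : 𝓡 {n = 2} (x ⊗ y ≐ y ⊗ x)
  ⊗-identity  : 𝓡 {n = 1} (x ⊗ 𝟙 ≐ x)
  ⊗-zero      : 𝓡 {n = 1} (x ⊗ 𝟘 ≐ 𝟘)
  distrib     : 𝓡 {n = 3} (x ⊗ (y ⊕ z) ≐ x ⊗ y ⊕ x ⊗ z)
  ≼-refl      : 𝓡 {n = 1} (x ≼ x)
  ≼-antisym   : 𝓡 {n = 2} (x ≼ y ∧ y ≼ x ⇒ x ≐ y)
  ≼-trans     : 𝓡 {n = 3} (x ≼ y ∧ y ≼ z ⇒ x ≼ z)
  ≼-total     : 𝓡 {n = 2} (x ≼ y ∨ y ≼ x)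
  ≼-discrete  : 𝓡 {n = 2} (x ≺ y ⇔ x ⊕ 𝟙 ≼ y)
  ⊕-mono-≺    : 𝓡 {n = 3} (x ≺ y ⇒ x ⊕ z ≺ y ⊕ z)
  ⊗-mono-≺    : 𝓡 {n = 3} (¬′ (z ≐ 𝟘) ∧ x ≺ y ⇒ x ⊗ z ≺ y ⊗ z)
  ⊖-def       : 𝓡 {n = 2} ((y ≼ x ⇒ (x ⊖ y) ⊕ y ≐ x) ∧ (x ≺ y ⇒ x ⊖ y ≐ 𝟘))
  ⊘-def       : 𝓡 {n = 2} ((y ⊕ 𝟙) ⊗ (x ⊘ y) ≼ x
                           ∧ x ⊖ (y ⊕ 𝟙) ⊗ (x ⊘ y) ≺ y ⊕ 𝟙)

data QuantifierFree {L : Language} {n : ℕ} : Formula L n → Set where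
  eq  : (s t : Term L n) → QuantifierFree (s ≐ t)
  rel : (r : Rel L k) (ts : Vec (Term L n) k) → QuantifierFree (rel r ts)
  bot : QuantifierFree ⊥′
  and : {φ ψ : Formula L n} → QuantifierFree φ → QuantifierFree ψ → QuantifierFree (φ ∧ ψ)
  or  : {φ ψ : Formula L n} → QuantifierFree φ → QuantifierFree ψ → QuantifierFree (φ ∨ ψ)
  imp : {φ ψ : Formula L n} → QuantifierFree φ → QuantifierFree ψ → QuantifierFree (φ ⇒ ψ)

data Bounded {L : Language} : {n : ℕ} → Formula L n → Set where
  eq  : (s t : Term L n) → Bounded (s ≐ t)
  rel : (r : Rel L k) (ts : Vec (Term L n) k) → Bounded (rel r ts)
  bot : Bounded {n = n} ⊥′
  and : {φ ψ : Formula L n} → Bounded φ → Bounded ψ → Bounded (φ ∧ ψ)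
  or  : {φ ψ : Formula L n} → Bounded φ → Bounded ψ → Bounded (φ ∨ ψ)
  imp : {φ ψ : Formula L n} → Bounded φ → Bounded ψ → Bounded (φ ⇒ ψ)
  all : (t : Term L n) {φ : Formula L (suc n)} → Bounded φ → Bounded (∀≤ t φ)
  exi : (t : Term L n) {φ : Formula L (suc n)} → Bounded φ → Bounded (∃≤ t φ)

-- Immediate subformulas of a bounded formula.  The bounded quantifiers
-- count as single connectives, so the only immediate subformula of
-- ∀x≤t φ and of ∃x≤t φ is φ.
data _◁_ {L : Language} : {m n : ℕ} → Formula L m → Formula L n → Set where
  and₁ : {φ ψ : Formula L n} → φ ◁ (φ ∧ ψ)
  and₂ : {φ ψ : Formula L n} → ψ ◁ (φ ∧ ψ)
  or₁  : {φ ψ : Formula L n} → φ ◁ (φ ∨ ψ)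
  or₂  : {φ ψ : Formula L n} → ψ ◁ (φ ∨ ψ)
  imp₁ : {φ ψ : Formula L n} → φ ◁ (φ ⇒ ψ)
  imp₂ : {φ ψ : Formula L n} → ψ ◁ (φ ⇒ ψ)
  all  : {t : Term L n} {φ : Formula L (suc n)} → φ ◁ ∀≤ t φ
  exi  : {t : Term L n} {φ : Formula L (suc n)} → φ ◁ ∃≤ t φ

ContainsQF : FormulaClass L → Set
ContainsQF {L} Ψ = {n : ℕ} {φ : Formula L n} → QuantifierFree φ → φ ∈ Ψ

ClosedUnderSubstitution : FormulaClass L → Set
ClosedUnderSubstitution {L} Ψ =
  {m n : ℕ} {φ : Formula L m} → φ ∈ Ψ → (σ : Sub L m n) → φ [ σ ] ∈ Ψ

ClosedUnderSubformulas : FormulaClass L → Set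
ClosedUnderSubformulas {L} Ψ =
  {m n : ℕ} {φ : Formula L m} {ψ : Formula L n} → φ ◁ ψ → ψ ∈ Ψ → φ ∈ Ψ

record ClosedUnderBoolean {L : Language} (Ψ : FormulaClass L) : Set where
  field
    ∧-closed : {φ ψ : Formula L n} → φ ∈ Ψ → ψ ∈ Ψ → φ ∧ ψ ∈ Ψ
    ∨-closed : {φ ψ : Formula L n} → φ ∈ Ψ → ψ ∈ Ψ → φ ∨ ψ ∈ Ψ
    ⇒-closed : {φ ψ : Formula L n} → φ ∈ Ψ → ψ ∈ Ψ → φ ⇒ ψ ∈ Ψ
    ¬-closed : {φ : Formula L n} → φ ∈ Ψ → ¬′ φ ∈ Ψ

-- (φ ∧ ψ) HasFormIn Ψ says that φ and ψ have an 𝓡-conjunction in Ψ, and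
-- similarly for the other connectives.
_HasFormIn_ : Formula L n → FormulaClass L → Set
_HasFormIn_ {L} {n} φ Ψ = ∃[ ψ ] (ψ ∈ Ψ) × (𝓡 ⊢ ψ ⇔ φ)

record IsπClass {L : Language} (Π : FormulaClass L) : Set where
  field
    quantifierFree : ContainsQF Π
    substitution   : ClosedUnderSubstitution Π
    subformulas    : ClosedUnderSubformulas Π
    conjunction    : {φ ψ : Formula L n} → φ ∈ Π → ψ ∈ Π → (φ ∧ ψ) HasFormIn Π
    disjunction    : {φ ψ : Formula L n} → φ ∈ Π → ψ ∈ Π → (φ ∨ ψ) HasFormIn Π
    universal      : {φ : Formula L (suc n)} (t : Term L n) → φ ∈ Π → (∀≤ t φ) HasFormIn Π
    negation       : {φ : Formula L (suc n)} {t : Term L n} → ∃≤ t φ ∈ Π →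
                     ((¬′ φ) HasFormIn Π) × ((¬′ ∀≤ t (¬′ φ)) HasFormIn Π)

record IsTermSet {L : Language} (𝓑 : Theory L) (𝕋 : TermClass L) : Set where
  field
    operations   : (f : ArithFunc k) {ts : Vec (Term L n) k} → All (λ t → t ∈ 𝕋) ts →
                   ∃[ t ] (t ∈ 𝕋) × (𝓑 ⊢ fun (arith f) ts ≐ t)
    -- Simultaneous substitution also covers renaming of variables, hence
    -- regarding a term as a term in a larger list of variables.
    substitution : {t : Term L m} → t ∈ 𝕋 → (σ : Sub L m n) →
                   ∃[ t′ ] (t′ ∈ 𝕋) × (𝓑 ⊢ t [ σ ]ᵗ ≐ t′)

-- 𝓑 ⊢ x⃗ ≤ y⃗ → r(x⃗) ≤ r(y⃗), in the 2n variables x⃗ , y⃗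
Monotone : Theory L → Term L n → Set
Monotone {L} {n} 𝓑 r =
  𝓑 ⊢ ⋀ (tabulate (λ i → xs i ≼ ys i)) ⇒ r [ xs ]ᵗ ≼ r [ ys ]ᵗ
  where
  xs ys : Sub L n (n + n)
  xs i = var (i ↑ˡ n)
  ys i = var (n ↑ʳ i)

record IsTermIdeal {L : Language} (𝓑 : Theory L) (𝕋 : TermClass L) : Set₁ where
  field
    isTermSet  : IsTermSet 𝓑 𝕋
    X          : TermClass L
    X⊆𝕋        : {n : ℕ} → X {n} ⊆ 𝕋
    majorizing : {t : Term L n} → t ∈ 𝕋 → ∃[ s ] (s ∈ X) × (𝓑 ⊢ t ≼ s)
    monotone   : {r : Term L n} → r ∈ X → Monotone 𝓑 r

data 𝔅 {L : Language} (𝕋 : TermClass L) (Ψ : FormulaClass L) (𝓐 : Theory L) :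
       {n : ℕ} → Formula L n → Set where
  axiom     : {φ : Formula L n} → φ ∈ 𝓐 → 𝔅 𝕋 Ψ 𝓐 φ
  induction : {A : Formula L (suc n)} {t : Term L (suc n)} → A ∈ Ψ → t ∈ 𝕋 →
              𝔅 𝕋 Ψ 𝓐 (A ⟨ 𝟘 ⟩ ∧ ∀′ (A ⇒ A ⟪ var zero ⊕ 𝟙 ⟫) ⇒ ∀′ (A ⟪ t ⟫))

-- The bounds of a block of a quantifiers, outermost first.  Each bound
-- may mention the variables quantified before it; in the scope of the
-- block these are x₀ , … , x_{a-1}, the innermost one being x₀.
data Bounds (L : Language) (n : ℕ) : ℕ → Set where
  []  : Bounds L n 0
  _▷_ : Bounds L n a → Term L (a + n) → Bounds L n (suc a)

∀≤* ∃≤* : Bounds L n a → Formula L (a + n) → Formula L n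
∀≤* []      φ = φ
∀≤* (p ▷ t) φ = ∀≤* p (∀≤ t φ)
∃≤* []      φ = φ
∃≤* (p ▷ t) φ = ∃≤* p (∃≤ t φ)

-- The formula u⃗ ≤ p⃗
within : Bounds L n a → Formula L (a + n)
within []      = ⊤′
within (p ▷ t) = wk (within p) ∧ var zero ≼ wkᵗ t

data ∀Block {L : Language} (Ψ : FormulaClass L) {n : ℕ} : Formula L n → Set where
  block : (p : Bounds L n a) {φ : Formula L (a + n)} → φ ∈ Ψ → ∀Block Ψ (∀≤* p φ)

data ∃Block {L : Language} (Ψ : FormulaClass L) {n : ℕ} : Formula L n → Set where
  block : (p : Bounds L n a) {φ : Formula L (a + n)} → φ ∈ Ψ → ∃Block Ψ (∃≤* p φ)

Π[_] Σ[_] : ℕ → FormulaClass L → FormulaClass L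
Π[ zero  ] Φ = Φ
Π[ suc k ] Φ = ∀Block (Σ[ k ] Φ)
Σ[ zero  ] Φ = Φ
Σ[ suc k ] Φ = ∃Block (Π[ k ] Φ)

-- The sequence F = (F₁ , … , Fₖ), headed by Fₖ.  Fₖ is a tuple of a
-- terms in the n variables x⃗ and b further ones, all of which remain
-- available to Fₖ₋₁.
data TermSeq (L : Language) (n : ℕ) : ℕ → Set where
  []  : TermSeq L n 0
  _∷_ : Vector (Term L (b + n)) a → TermSeq L (b + n) k → TermSeq L n (suc k)

-- C(x⃗ , u⃗) ↦ C(x⃗ , F)
plug : Vector (Term L (b + n)) a → Formula L (a + n) → Formula L (b + n)
plug {b = b} F C = C [ F ++ᵛ (λ i → var (b ↑ʳ i)) ]

-- Reduceᴾ Φ 𝓑 Γ F A B  says  A ≤_d^{F,k} B  for A , B ∈ Πₖ(Φ), and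
-- Reduceˢ Φ 𝓑 Γ F A B  the same for A , B ∈ Σₖ(Φ), where 𝓑 may use the
-- additional hypotheses Γ.  The formulas compared at the next level,
-- (F ≤ p → C(F)) etc., are replaced by 𝓡-equivalent C′ , D′ of the
-- class required there.
mutual
  data Reduceᴾ {L : Language} (Φ : FormulaClass L) (𝓑 : Theory L) {n : ℕ}
         (Γ : List (Formula L n)) :
         {k : ℕ} → TermSeq L n k → Formula L n → Formula L n → Set where
    base : {A B : Formula L n} → A ∈ Φ → B ∈ Φ → 𝓑 ∣ Γ ⊢ A ⇒ B →
           Reduceᴾ Φ 𝓑 Γ [] A B
    step : (p : Bounds L n a) (q : Bounds L n b)
           {C : Formula L (a + n)} {D : Formula L (b + n)} {C′ D′ : Formula L (b + n)}
           {F : Vector (Term L (b + n)) a} {F̂ : TermSeq L (b + n) k} →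
           C ∈ Σ[ k ] Φ → D ∈ Σ[ k ] Φ →
           𝓑 ∣ map (wk* b) Γ ⊢ within q ⇒ plug F (within p) →
           𝓡 ⊢ C′ ⇔ (plug F (within p) ⇒ plug F C) →
           𝓡 ⊢ D′ ⇔ (within q ⇒ D) →
           Reduceˢ Φ 𝓑 (map (wk* b) Γ) F̂ C′ D′ →
           Reduceᴾ Φ 𝓑 Γ (F ∷ F̂) (∀≤* p C) (∀≤* q D)

  data Reduceˢ {L : Language} (Φ : FormulaClass L) (𝓑 : Theory L) {n : ℕ}
         (Γ : List (Formula L n)) :
         {k : ℕ} → TermSeq L n k → Formula L n → Formula L n → Set where
    base : {A B : Formula L n} → A ∈ Φ → B ∈ Φ → 𝓑 ∣ Γ ⊢ A ⇒ B →
           Reduceˢ Φ 𝓑 Γ [] A B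
    step : (p : Bounds L n a) (q : Bounds L n b)
           {C : Formula L (a + n)} {D : Formula L (b + n)} {C′ D′ : Formula L (a + n)}
           {F : Vector (Term L (a + n)) b} {F̂ : TermSeq L (a + n) k} →
           C ∈ Π[ k ] Φ → D ∈ Π[ k ] Φ →
           𝓑 ∣ map (wk* a) Γ ⊢ within p ⇒ plug F (within q) →
           𝓡 ⊢ C′ ⇔ (within p ∧ C) →
           𝓡 ⊢ D′ ⇔ (plug F (within q) ∧ plug F D) →
           Reduceᴾ Φ 𝓑 (map (wk* a) Γ) F̂ C′ D′ →
           Reduceˢ Φ 𝓑 Γ (F ∷ F̂) (∃≤* p C) (∃≤* q D)

Equivᴾ : FormulaClass L → Theory L → TermSeq L n k → TermSeq L n k →
         Formula L n → Formula L n → Set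
Equivᴾ Φ 𝓑 E₀ E₁ A B = Reduceᴾ Φ 𝓑 [] E₀ A B × Reduceᴾ Φ 𝓑 [] E₁ B A

-- In H(u , x⃗) the variable u is x₀.

record DetFlow {L : Language} (k : ℕ) (Φ : FormulaClass L) (𝓑 : Theory L) {n : ℕ}
         (A B : Formula L n) : Set where
  field
    t           : Term L n
    H           : Formula L (suc n)
    H∈Π         : H ∈ Π[ k ] Φ
    E₀ E₁ G₀ G₁ : TermSeq L n k
    F           : TermSeq L (suc n) k
    start       : Equivᴾ Φ 𝓑 E₀ E₁ (H ⟨ 𝟘 ⟩) A
    end         : Equivᴾ Φ 𝓑 G₀ G₁ (H ⟨ t ⟩) B
    next        : Reduceᴾ Φ 𝓑 (var zero ≺ wkᵗ t ∷ []) F H (H ⟪ var zero ⊕ 𝟙 ⟫)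

record NondetFlow {L : Language} (𝕋 : TermClass L) (Π : FormulaClass L) (𝓑 : Theory L)
         {n : ℕ} (A B : Formula L n) : Set where
  field
    t     : Term L n
    t∈𝕋   : t ∈ 𝕋
    H     : Formula L (suc n)
    H∈Π   : H ∈ Π
    start : 𝓑 ⊢ H ⟨ 𝟘 ⟩ ⇔ A
    end   : 𝓑 ⊢ H ⟨ t ⟩ ⇔ B
    next  : 𝓑 ⊢ ∀′ (var zero ≺ wkᵗ t ⇒ (H ⇒ H ⟪ var zero ⊕ 𝟙 ⟫))

-- Γ ▷ Δ for multisets: ⋀Γ and ⋁Δ are replaced by 𝓡-equivalent members
-- A , B of the class.
FlowBetween : FormulaClass L → (Formula L n → Formula L n → Set) →
              List (Formula L n) → List (Formula L n) → Set
FlowBetween Ψ Flow Γ Δ =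
  ∃[ A ] ∃[ B ]
    (A ∈ Ψ) × (B ∈ Ψ) × (𝓡 ⊢ A ⇔ ⋀ Γ) × (𝓡 ⊢ B ⇔ ⋁ Δ) × Flow A B

_⊢_⟹_ : Theory L → List (Formula L n) → List (Formula L n) → Set
T ⊢ Γ ⟹ Δ = T ⊢ ⋀ Γ ⇒ ⋁ Δ

{-# OPTIONS --safe #-}
module Submission where

-- A flow step is only available below t, whereas the induction axioms carry
-- no guard.  So induction is applied to H(min(u , t)) instead of H(u), where
-- min(u , t) = u ∸ (u ∸ t): this is a substitution instance of H, hence in the
-- same class, and it makes the step trivial from t onwards.  A deterministic
-- reduction only enters through the implication that it witnesses.

open import Defs
open import Data.Nat.Base using (ℕ; zero; suc; _+_)
open import Data.Fin.Base using (zero; suc; _↑ʳ_)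
open import Data.Fin.Patterns using (0F; 1F; 2F)
open import Data.List.Base using (List; []; _∷_; map)
open import Data.List.Properties using (map-∘; map-cong; map-id)
open import Data.List.Membership.Propositional.Properties using (∈-map⁺)
open import Data.List.Relation.Binary.Subset.Propositional using () renaming (_⊆_ to _⊆ˡ_)
open import Data.List.Relation.Binary.Subset.Propositional.Properties
  using (map⁺; ∷⁺ʳ; xs⊆x∷xs)
open import Data.List.Relation.Unary.All using (All)
open import Data.List.Relation.Unary.Any using (here)
open import Data.Product.Base using (∃-syntax; _×_; _,_; proj₁; proj₂)
open import Data.Unit.Base using (tt)
open import Data.Vec.Base using (Vec; []; _∷_)
open import Data.Vec.Functional using (Vector) renaming (_∷_ to _∷ᵛ_; _++_ to _++ᵛ_; [] to []ᵛ)
open import Data.Vec.Functional.Properties using (lookup-++ʳ)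
open import Function.Base using (_∘_)
open import Relation.Unary using (_∈_)
open import Relation.Binary.PropositionalEquality
  using (_≡_; refl; sym; trans; cong; cong₂; subst)

private
  variable
    L : Language
    T : Theory L
    a b k l m n : ℕ
    Γ Δ : List (Formula L n)
    φ ψ χ : Formula L n

-- Substitution calculus

mutual
  []ᵗ-cong : {σ τ : Sub L m n} → (∀ i → σ i ≡ τ i) → ∀ t → t [ σ ]ᵗ ≡ t [ τ ]ᵗ
  []ᵗ-cong σ≗τ (var i)    = σ≗τ i
  []ᵗ-cong σ≗τ (fun f ts) = cong (fun f) ([]ˢ-cong σ≗τ ts)

  []ˢ-cong : {σ τ : Sub L m n} → (∀ i → σ i ≡ τ i) →
             (ts : Vec (Term L m) k) → ts [ σ ]ˢ ≡ ts [ τ ]ˢ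
  []ˢ-cong σ≗τ []       = refl
  []ˢ-cong σ≗τ (t ∷ ts) = cong₂ _∷_ ([]ᵗ-cong σ≗τ t) ([]ˢ-cong σ≗τ ts)

mutual
  []ᵗ-id : {σ : Sub L n n} → (∀ i → σ i ≡ var i) → ∀ t → t [ σ ]ᵗ ≡ t
  []ᵗ-id σ≗var (var i)    = σ≗var i
  []ᵗ-id σ≗var (fun f ts) = cong (fun f) ([]ˢ-id σ≗var ts)

  []ˢ-id : {σ : Sub L n n} → (∀ i → σ i ≡ var i) →
           (ts : Vec (Term L n) k) → ts [ σ ]ˢ ≡ ts
  []ˢ-id σ≗var []       = refl
  []ˢ-id σ≗var (t ∷ ts) = cong₂ _∷_ ([]ᵗ-id σ≗var t) ([]ˢ-id σ≗var ts)

mutual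
  -- The composite `ρ` is given only pointwise, so that under a binder `lift ρ` can take the place
  -- of the composite of the lifts. The commutation laws of substitution then reduce to checks on
  -- variables.
  []ᵗ-fuse : {σ : Sub L l m} {τ : Sub L m n} {ρ : Sub L l n} →
             (∀ i → σ i [ τ ]ᵗ ≡ ρ i) → ∀ t → t [ σ ]ᵗ [ τ ]ᵗ ≡ t [ ρ ]ᵗ
  []ᵗ-fuse στ≗ρ (var i)    = στ≗ρ i
  []ᵗ-fuse στ≗ρ (fun f ts) = cong (fun f) ([]ˢ-fuse στ≗ρ ts)

  []ˢ-fuse : {σ : Sub L l m} {τ : Sub L m n} {ρ : Sub L l n} →
             (∀ i → σ i [ τ ]ᵗ ≡ ρ i) → (ts : Vec (Term L l) k) → ts [ σ ]ˢ [ τ ]ˢ ≡ ts [ ρ ]ˢ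
  []ˢ-fuse στ≗ρ []       = refl
  []ˢ-fuse στ≗ρ (t ∷ ts) = cong₂ _∷_ ([]ᵗ-fuse στ≗ρ t) ([]ˢ-fuse στ≗ρ ts)

wkᵗ-∷ : (s : Term L n) (σ : Sub L m n) (t : Term L m) → wkᵗ t [ s ∷ᵛ σ ]ᵗ ≡ t [ σ ]ᵗ
wkᵗ-∷ s σ = []ᵗ-fuse (λ _ → refl)

wkᵗ-⟨⟩ : (s t : Term L n) → wkᵗ t [ s ∷ᵛ var ]ᵗ ≡ t
wkᵗ-⟨⟩ s t = trans (wkᵗ-∷ s var t) ([]ᵗ-id (λ _ → refl) t)

wkᵗ-lift : (σ : Sub L m n) (t : Term L m) → wkᵗ t [ lift σ ]ᵗ ≡ wkᵗ (t [ σ ]ᵗ)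
wkᵗ-lift σ t = trans ([]ᵗ-fuse (λ _ → refl) t) (sym ([]ᵗ-fuse (λ _ → refl) t))

lift-cong : {σ τ : Sub L m n} → (∀ i → σ i ≡ τ i) → ∀ i → lift σ i ≡ lift τ i
lift-cong σ≗τ zero    = refl
lift-cong σ≗τ (suc i) = cong wkᵗ (σ≗τ i)

lift-id : {σ : Sub L n n} → (∀ i → σ i ≡ var i) → ∀ i → lift σ i ≡ var i
lift-id σ≗var zero    = refl
lift-id σ≗var (suc i) = cong wkᵗ (σ≗var i)

lift-fuse : {σ : Sub L l m} {τ : Sub L m n} {ρ : Sub L l n} →
            (∀ i → σ i [ τ ]ᵗ ≡ ρ i) → ∀ i → lift σ i [ lift τ ]ᵗ ≡ lift ρ i
lift-fuse                 στ≗ρ zero    = refl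
lift-fuse {σ = σ} {τ = τ} στ≗ρ (suc i) = trans (wkᵗ-lift τ (σ i)) (cong wkᵗ (στ≗ρ i))

[]-cong : {σ τ : Sub L m n} → (∀ i → σ i ≡ τ i) → ∀ φ → φ [ σ ] ≡ φ [ τ ]
[]-cong σ≗τ (s ≐ t)    = cong₂ _≐_ ([]ᵗ-cong σ≗τ s) ([]ᵗ-cong σ≗τ t)
[]-cong σ≗τ (rel r ts) = cong (rel r) ([]ˢ-cong σ≗τ ts)
[]-cong σ≗τ ⊥′         = refl
[]-cong σ≗τ (φ ∧ ψ)    = cong₂ _∧_ ([]-cong σ≗τ φ) ([]-cong σ≗τ ψ)
[]-cong σ≗τ (φ ∨ ψ)    = cong₂ _∨_ ([]-cong σ≗τ φ) ([]-cong σ≗τ ψ)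
[]-cong σ≗τ (φ ⇒ ψ)    = cong₂ _⇒_ ([]-cong σ≗τ φ) ([]-cong σ≗τ ψ)
[]-cong σ≗τ (∀′ φ)     = cong ∀′ ([]-cong (lift-cong σ≗τ) φ)
[]-cong σ≗τ (∃′ φ)     = cong ∃′ ([]-cong (lift-cong σ≗τ) φ)

[]-id : {σ : Sub L n n} → (∀ i → σ i ≡ var i) → ∀ φ → φ [ σ ] ≡ φ
[]-id σ≗var (s ≐ t)    = cong₂ _≐_ ([]ᵗ-id σ≗var s) ([]ᵗ-id σ≗var t)
[]-id σ≗var (rel r ts) = cong (rel r) ([]ˢ-id σ≗var ts)
[]-id σ≗var ⊥′         = refl
[]-id σ≗var (φ ∧ ψ)    = cong₂ _∧_ ([]-id σ≗var φ) ([]-id σ≗var ψ)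
[]-id σ≗var (φ ∨ ψ)    = cong₂ _∨_ ([]-id σ≗var φ) ([]-id σ≗var ψ)
[]-id σ≗var (φ ⇒ ψ)    = cong₂ _⇒_ ([]-id σ≗var φ) ([]-id σ≗var ψ)
[]-id σ≗var (∀′ φ)     = cong ∀′ ([]-id (lift-id σ≗var) φ)
[]-id σ≗var (∃′ φ)     = cong ∃′ ([]-id (lift-id σ≗var) φ)

[]-fuse : {σ : Sub L l m} {τ : Sub L m n} {ρ : Sub L l n} →
          (∀ i → σ i [ τ ]ᵗ ≡ ρ i) → ∀ φ → φ [ σ ] [ τ ] ≡ φ [ ρ ]
[]-fuse στ≗ρ (s ≐ t)    = cong₂ _≐_ ([]ᵗ-fuse στ≗ρ s) ([]ᵗ-fuse στ≗ρ t)
[]-fuse στ≗ρ (rel r ts) = cong (rel r) ([]ˢ-fuse στ≗ρ ts)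
[]-fuse στ≗ρ ⊥′         = refl
[]-fuse στ≗ρ (φ ∧ ψ)    = cong₂ _∧_ ([]-fuse στ≗ρ φ) ([]-fuse στ≗ρ ψ)
[]-fuse στ≗ρ (φ ∨ ψ)    = cong₂ _∨_ ([]-fuse στ≗ρ φ) ([]-fuse στ≗ρ ψ)
[]-fuse στ≗ρ (φ ⇒ ψ)    = cong₂ _⇒_ ([]-fuse στ≗ρ φ) ([]-fuse στ≗ρ ψ)
[]-fuse {σ = σ} {τ} στ≗ρ (∀′ φ) = cong ∀′ ([]-fuse (lift-fuse {σ = σ} {τ} στ≗ρ) φ)
[]-fuse {σ = σ} {τ} στ≗ρ (∃′ φ) = cong ∃′ ([]-fuse (lift-fuse {σ = σ} {τ} στ≗ρ) φ)

[]-square : {σ : Sub L l m} {τ : Sub L m n} {σ′ : Sub L l k} {τ′ : Sub L k n} →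
            (∀ i → σ i [ τ ]ᵗ ≡ σ′ i [ τ′ ]ᵗ) → ∀ φ → φ [ σ ] [ τ ] ≡ φ [ σ′ ] [ τ′ ]
[]-square h φ = trans ([]-fuse h φ) (sym ([]-fuse (λ _ → refl) φ))

wk-lift : (σ : Sub L m n) (φ : Formula L m) → wk φ [ lift σ ] ≡ wk (φ [ σ ])
wk-lift σ = []-square (λ _ → refl)

⟨⟩-[] : (σ : Sub L m n) (t : Term L m) (φ : Formula L (suc m)) →
        φ ⟨ t ⟩ [ σ ] ≡ (φ [ lift σ ]) ⟨ t [ σ ]ᵗ ⟩
⟨⟩-[] σ t = []-square λ where
  zero    → refl
  (suc i) → sym (wkᵗ-⟨⟩ _ (σ i))

lift-⟨⟩ : (σ : Sub L m n) (t : Term L n) (φ : Formula L (suc m)) →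
          (φ [ lift σ ]) ⟨ t ⟩ ≡ φ [ t ∷ᵛ σ ]
lift-⟨⟩ σ t = []-fuse λ where
  zero    → refl
  (suc i) → wkᵗ-⟨⟩ t (σ i)

map-wk-lift : (σ : Sub L m n) (Γ : List (Formula L m)) →
              map _[ lift σ ] (map wk Γ) ≡ map wk (map _[ σ ] Γ)
map-wk-lift σ Γ = trans (sym (map-∘ Γ)) (trans (map-cong (wk-lift σ) Γ) (map-∘ Γ))

wk*-suc : (b : ℕ) (φ : Formula L n) → wk* (suc b) φ ≡ wk (wk* b φ)
wk*-suc b φ = sym ([]-fuse (λ _ → refl) φ)

map-wk*-zero : (Γ : List (Formula L n)) → map (wk* 0) Γ ≡ Γ
map-wk*-zero Γ = trans (map-cong ([]-id (λ _ → refl)) Γ) (map-id Γ)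

map-wk*-suc : (b : ℕ) (Γ : List (Formula L n)) → map (wk* (suc b)) Γ ≡ map wk (map (wk* b) Γ)
map-wk*-suc b Γ = trans (map-cong (wk*-suc b) Γ) (map-∘ Γ)

-- Admissible rules

cast : φ ≡ ψ → T ∣ Γ ⊢ φ → T ∣ Γ ⊢ ψ
cast {T = T} {Γ = Γ} = subst (T ∣ Γ ⊢_)

castᶜ : Γ ≡ Δ → T ∣ Γ ⊢ φ → T ∣ Δ ⊢ φ
castᶜ {T = T} {φ = φ} = subst (T ∣_⊢ φ)

weaken : Γ ⊆ˡ Δ → T ∣ Γ ⊢ φ → T ∣ Δ ⊢ φ
weaken Γ⊆Δ (ax φ∈T σ)   = ax φ∈T σ
weaken Γ⊆Δ (hyp φ∈Γ)    = hyp (Γ⊆Δ φ∈Γ)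
weaken Γ⊆Δ (raa d)      = raa (weaken (∷⁺ʳ _ Γ⊆Δ) d)
weaken Γ⊆Δ (∧I d e)     = ∧I (weaken Γ⊆Δ d) (weaken Γ⊆Δ e)
weaken Γ⊆Δ (∧E₁ d)      = ∧E₁ (weaken Γ⊆Δ d)
weaken Γ⊆Δ (∧E₂ d)      = ∧E₂ (weaken Γ⊆Δ d)
weaken Γ⊆Δ (∨I₁ d)      = ∨I₁ (weaken Γ⊆Δ d)
weaken Γ⊆Δ (∨I₂ d)      = ∨I₂ (weaken Γ⊆Δ d)
weaken Γ⊆Δ (∨E d e f)   = ∨E (weaken Γ⊆Δ d) (weaken (∷⁺ʳ _ Γ⊆Δ) e) (weaken (∷⁺ʳ _ Γ⊆Δ) f)
weaken Γ⊆Δ (⇒I d)       = ⇒I (weaken (∷⁺ʳ _ Γ⊆Δ) d)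
weaken Γ⊆Δ (⇒E d e)     = ⇒E (weaken Γ⊆Δ d) (weaken Γ⊆Δ e)
weaken Γ⊆Δ (∀I d)       = ∀I (weaken (map⁺ wk Γ⊆Δ) d)
weaken Γ⊆Δ (∀E d t)     = ∀E (weaken Γ⊆Δ d) t
weaken Γ⊆Δ (∃I t d)     = ∃I t (weaken Γ⊆Δ d)
weaken Γ⊆Δ (∃E d e)     = ∃E (weaken Γ⊆Δ d) (weaken (∷⁺ʳ _ (map⁺ wk Γ⊆Δ)) e)
weaken Γ⊆Δ ≐I           = ≐I
weaken Γ⊆Δ (≐E φ d e)   = ≐E φ (weaken Γ⊆Δ d) (weaken Γ⊆Δ e)

weaken₁ : T ∣ Γ ⊢ φ → T ∣ ψ ∷ Γ ⊢ φ
weaken₁ = weaken (xs⊆x∷xs _ _)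

weaken₀ : T ⊢ φ → T ∣ Γ ⊢ φ
weaken₀ = weaken λ ()

-- By induction on the derivation. At `ax` the substitution is absorbed by composing it with the one
-- that the rule carries; in `∀I` and `∃E` it is lifted past the new variable.
instantiate : T ∣ Γ ⊢ φ → (σ : Sub L m n) → T ∣ map _[ σ ] Γ ⊢ φ [ σ ]
instantiate (ax {φ = φ} φ∈T τ) σ = cast (sym ([]-fuse (λ _ → refl) φ)) (ax φ∈T (λ i → τ i [ σ ]ᵗ))
instantiate (hyp φ∈Γ)    σ = hyp (∈-map⁺ _[ σ ] φ∈Γ)
instantiate (raa d)      σ = raa (instantiate d σ)
instantiate (∧I d e)     σ = ∧I (instantiate d σ) (instantiate e σ)
instantiate (∧E₁ d)      σ = ∧E₁ (instantiate d σ)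
instantiate (∧E₂ d)      σ = ∧E₂ (instantiate d σ)
instantiate (∨I₁ d)      σ = ∨I₁ (instantiate d σ)
instantiate (∨I₂ d)      σ = ∨I₂ (instantiate d σ)
instantiate (∨E d e f)   σ = ∨E (instantiate d σ) (instantiate e σ) (instantiate f σ)
instantiate (⇒I d)       σ = ⇒I (instantiate d σ)
instantiate (⇒E d e)     σ = ⇒E (instantiate d σ) (instantiate e σ)
instantiate (∀I {Γ = Γ} d) σ = ∀I (castᶜ (map-wk-lift σ Γ) (instantiate d (lift σ)))
instantiate (∀E {φ = φ} d t) σ = cast (sym (⟨⟩-[] σ t φ)) (∀E (instantiate d σ) (t [ σ ]ᵗ))
instantiate (∃I {φ = φ} t d) σ = ∃I (t [ σ ]ᵗ) (cast (⟨⟩-[] σ t φ) (instantiate d σ))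
instantiate (∃E {Γ = Γ} {χ = χ} d e) σ =
  ∃E (instantiate d σ)
     (cast (wk-lift σ χ) (castᶜ (cong (_ ∷_) (map-wk-lift σ Γ)) (instantiate e (lift σ))))
instantiate ≐I           σ = ≐I
instantiate (≐E {s = s} {t} φ d e) σ =
  cast (sym (⟨⟩-[] σ t φ))
       (≐E (φ [ lift σ ]) (instantiate d σ) (cast (⟨⟩-[] σ s φ) (instantiate e σ)))

module _ {S T : Theory L} (S⊑T : S ⊑ T) where

  -- Each use of an axiom of `S` becomes its derivation in `T`, under the substitution attached to
  -- that use; all other rules carry over.
  ⊢-mono : {Γ : List (Formula L n)} {φ : Formula L n} → S ∣ Γ ⊢ φ → T ∣ Γ ⊢ φ
  ⊢-mono (ax φ∈S σ) = weaken₀ (instantiate (S⊑T φ∈S) σ)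
  ⊢-mono (hyp φ∈Γ)  = hyp φ∈Γ
  ⊢-mono (raa d)    = raa (⊢-mono d)
  ⊢-mono (∧I d e)   = ∧I (⊢-mono d) (⊢-mono e)
  ⊢-mono (∧E₁ d)    = ∧E₁ (⊢-mono d)
  ⊢-mono (∧E₂ d)    = ∧E₂ (⊢-mono d)
  ⊢-mono (∨I₁ d)    = ∨I₁ (⊢-mono d)
  ⊢-mono (∨I₂ d)    = ∨I₂ (⊢-mono d)
  ⊢-mono (∨E d e f) = ∨E (⊢-mono d) (⊢-mono e) (⊢-mono f)
  ⊢-mono (⇒I d)     = ⇒I (⊢-mono d)
  ⊢-mono (⇒E d e)   = ⇒E (⊢-mono d) (⊢-mono e)
  ⊢-mono (∀I d)     = ∀I (⊢-mono d)
  ⊢-mono (∀E d t)   = ∀E (⊢-mono d) t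
  ⊢-mono (∃I t d)   = ∃I t (⊢-mono d)
  ⊢-mono (∃E d e)   = ∃E (⊢-mono d) (⊢-mono e)
  ⊢-mono ≐I         = ≐I
  ⊢-mono (≐E φ d e) = ≐E φ (⊢-mono d) (⊢-mono e)

hyp₀ : T ∣ φ ∷ Γ ⊢ φ
hyp₀ = hyp (here refl)

axiom-⊢ : φ ∈ T → T ⊢ φ
axiom-⊢ {φ = φ} φ∈T = cast ([]-id (λ _ → refl) φ) (ax φ∈T var)

cut : T ∣ Γ ⊢ φ → T ∣ φ ∷ Γ ⊢ ψ → T ∣ Γ ⊢ ψ
cut d e = ⇒E (⇒I e) d

⇒-trans : T ∣ Γ ⊢ φ ⇒ ψ → T ∣ Γ ⊢ ψ ⇒ χ → T ∣ Γ ⊢ φ ⇒ χ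
⇒-trans d e = ⇒I (⇒E (weaken₁ e) (⇒E (weaken₁ d) hyp₀))

⊥E : T ∣ Γ ⊢ ⊥′ → T ∣ Γ ⊢ φ
⊥E d = raa (weaken₁ d)

excluded-middle : (φ : Formula L n) → T ∣ Γ ⊢ φ ∨ ¬′ φ
excluded-middle φ =
  raa (⇒E hyp₀ (∨I₂ (⇒I (⇒E (weaken₁ hyp₀) (∨I₁ hyp₀)))))

by-cases : (φ : Formula L n) → T ∣ φ ∷ Γ ⊢ ψ → T ∣ ¬′ φ ∷ Γ ⊢ ψ → T ∣ Γ ⊢ ψ
by-cases φ = ∨E (excluded-middle φ)

-- `φ` serves as a template: x₀ marks the occurrences to rewrite and `σ` fills the other places. An
-- occurrence of `s` that must stay is passed through `σ`, which is how congruence rules arise from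
-- `≐I`.
≐-replace : (φ : Formula L (suc m)) (σ : Sub L m n) {s t : Term L n} →
            T ∣ Γ ⊢ s ≐ t → T ∣ Γ ⊢ φ [ s ∷ᵛ σ ] → T ∣ Γ ⊢ φ [ t ∷ᵛ σ ]
≐-replace φ σ {s} {t} d e =
  cast (lift-⟨⟩ σ t φ) (≐E (φ [ lift σ ]) d (cast (sym (lift-⟨⟩ σ s φ)) e))

≐-sym : {s t : Term L n} → T ∣ Γ ⊢ s ≐ t → T ∣ Γ ⊢ t ≐ s
≐-sym {s = s} d = ≐-replace (var 0F ≐ var 1F) (s ∷ᵛ []ᵛ) d ≐I

≐-trans : {r s t : Term L n} → T ∣ Γ ⊢ r ≐ s → T ∣ Γ ⊢ s ≐ t → T ∣ Γ ⊢ r ≐ t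
≐-trans {r = r} d e = ≐-replace (var 1F ≐ var 0F) (r ∷ᵛ []ᵛ) e d

-- Arithmetic in extensions of 𝓡

min : Term L n → Term L n → Term L n
min u t = u ⊖ (u ⊖ t)

module Arithmetic {L : Language} {T : Theory L} (𝓡⊑T : 𝓡 ⊑ T) where

  private
    variable
      Ξ : List (Formula L n)
      r s t u : Term L n

  𝓡-ax : {φ : Formula L m} → 𝓡 φ → (σ : Sub L m n) → T ∣ Ξ ⊢ φ [ σ ]
  𝓡-ax φ∈𝓡 σ = ⊢-mono 𝓡⊑T (ax φ∈𝓡 σ)

  ⊕-congˡ : T ∣ Ξ ⊢ s ≐ t → T ∣ Ξ ⊢ s ⊕ r ≐ t ⊕ r
  ⊕-congˡ {s = s} {r = r} d =
    ≐-replace (var 1F ⊕ var 2F ≐ var 0F ⊕ var 2F) (s ∷ᵛ r ∷ᵛ []ᵛ) d ≐I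

  ⊗-congʳ : T ∣ Ξ ⊢ s ≐ t → T ∣ Ξ ⊢ r ⊗ s ≐ r ⊗ t
  ⊗-congʳ {s = s} {r = r} d =
    ≐-replace (var 2F ⊗ var 1F ≐ var 2F ⊗ var 0F) (s ∷ᵛ r ∷ᵛ []ᵛ) d ≐I

  ⊖-congʳ : T ∣ Ξ ⊢ s ≐ t → T ∣ Ξ ⊢ r ⊖ s ≐ r ⊖ t
  ⊖-congʳ {s = s} {r = r} d =
    ≐-replace (var 2F ⊖ var 1F ≐ var 2F ⊖ var 0F) (s ∷ᵛ r ∷ᵛ []ᵛ) d ≐I

  ≼-respˡ : T ∣ Ξ ⊢ s ≐ t → T ∣ Ξ ⊢ s ≼ r → T ∣ Ξ ⊢ t ≼ r
  ≼-respˡ {r = r} = ≐-replace (var 0F ≼ var 1F) (r ∷ᵛ []ᵛ)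

  ≼-respʳ : T ∣ Ξ ⊢ s ≐ t → T ∣ Ξ ⊢ r ≼ s → T ∣ Ξ ⊢ r ≼ t
  ≼-respʳ {r = r} = ≐-replace (var 1F ≼ var 0F) (r ∷ᵛ []ᵛ)

  ≼-reflexive : T ∣ Ξ ⊢ s ≐ t → T ∣ Ξ ⊢ s ≼ t
  ≼-reflexive {s = s} d = ≼-respʳ d (𝓡-ax ≼-refl (s ∷ᵛ []ᵛ))

  ≺-⊕𝟙 : (t : Term L n) → T ∣ Ξ ⊢ t ≺ t ⊕ 𝟙
  ≺-⊕𝟙 t = ⇒E (∧E₂ (𝓡-ax ≼-discrete (t ∷ᵛ (t ⊕ 𝟙) ∷ᵛ []ᵛ))) (≼-reflexive ≐I)

  ⊕𝟙-≼ : T ∣ Ξ ⊢ s ≺ t → T ∣ Ξ ⊢ s ⊕ 𝟙 ≼ t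
  ⊕𝟙-≼ {s = s} {t} = ⇒E (∧E₁ (𝓡-ax ≼-discrete (s ∷ᵛ t ∷ᵛ []ᵛ)))

  ⊕-mono-≼ : T ∣ Ξ ⊢ s ≼ t → T ∣ Ξ ⊢ s ⊕ r ≼ t ⊕ r
  ⊕-mono-≼ {s = s} {t} {r} d = by-cases (s ≐ t)
    (≼-reflexive (⊕-congˡ hyp₀))
    (∧E₁ (⇒E (𝓡-ax ⊕-mono-≺ (s ∷ᵛ t ∷ᵛ r ∷ᵛ []ᵛ)) (∧I (weaken₁ d) hyp₀)))

  𝟘⊕ : (t : Term L n) → T ∣ Ξ ⊢ 𝟘 ⊕ t ≐ t
  𝟘⊕ t = ≐-trans (𝓡-ax ⊕-comm (𝟘 ∷ᵛ t ∷ᵛ []ᵛ)) (𝓡-ax ⊕-identity (t ∷ᵛ []ᵛ))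

  -- For t ≠ 0, multiplying 0 < 1 by t gives 0 < t.
  𝟘-least : T ∣ Ξ ⊢ 𝟘 ≼ t
  𝟘-least {t = t} = by-cases (t ≐ 𝟘)
    (≼-reflexive (≐-sym hyp₀))
    (≼-respˡ 𝟘⊗t (≼-respʳ 1⊗t (∧E₁
      (⇒E (𝓡-ax ⊗-mono-≺ (𝟘 ∷ᵛ (𝟘 ⊕ 𝟙) ∷ᵛ t ∷ᵛ []ᵛ)) (∧I hyp₀ (≺-⊕𝟙 𝟘))))))
    where
    𝟘⊗t : T ∣ Ξ ⊢ 𝟘 ⊗ t ≐ 𝟘
    𝟘⊗t = ≐-trans (𝓡-ax ⊗-comm (𝟘 ∷ᵛ t ∷ᵛ []ᵛ)) (𝓡-ax ⊗-zero (t ∷ᵛ []ᵛ))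

    1⊗t : T ∣ Ξ ⊢ (𝟘 ⊕ 𝟙) ⊗ t ≐ t
    1⊗t = ≐-trans (𝓡-ax ⊗-comm ((𝟘 ⊕ 𝟙) ∷ᵛ t ∷ᵛ []ᵛ))
                  (≐-trans (⊗-congʳ (𝟘⊕ 𝟙)) (𝓡-ax ⊗-identity (t ∷ᵛ []ᵛ)))

  ≺-or-≽ : (s t : Term L n) → T ∣ Ξ ⊢ s ≺ t ∨ t ≼ s
  ≺-or-≽ s t = by-cases (s ≐ t)
    (∨I₂ (≼-reflexive (≐-sym hyp₀)))
    (∨E (𝓡-ax ≼-total (s ∷ᵛ t ∷ᵛ []ᵛ)) (∨I₁ (∧I hyp₀ (weaken₁ hyp₀))) (∨I₂ hyp₀))

  ≺⇒⊕-≢ : T ∣ Ξ ⊢ s ≺ t → T ∣ Ξ ⊢ ¬′ (s ⊕ r ≐ t ⊕ r)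
  ≺⇒⊕-≢ {s = s} {t} {r} d = ∧E₂ (⇒E (𝓡-ax ⊕-mono-≺ (s ∷ᵛ t ∷ᵛ r ∷ᵛ []ᵛ)) d)

  -- If s and t differed, one would be strictly smaller by totality, and strict monotonicity of
  -- addition would keep the two sums apart.
  ⊕-cancelʳ : T ∣ Ξ ⊢ s ⊕ r ≐ t ⊕ r → T ∣ Ξ ⊢ s ≐ t
  ⊕-cancelʳ {s = s} {t = t} d = raa (∨E (𝓡-ax ≼-total (s ∷ᵛ t ∷ᵛ []ᵛ))
    (⇒E (≺⇒⊕-≢ (∧I hyp₀ (weaken₁ hyp₀))) (weaken₁ (weaken₁ d)))
    (⇒E (≺⇒⊕-≢ (∧I hyp₀ (⇒I (⇒E (weaken₁ (weaken₁ hyp₀)) (≐-sym hyp₀)))))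
        (weaken₁ (weaken₁ (≐-sym d)))))

  ⊖-⊕ : T ∣ Ξ ⊢ t ≼ s → T ∣ Ξ ⊢ (s ⊖ t) ⊕ t ≐ s
  ⊖-⊕ {t = t} {s} = ⇒E (∧E₁ (𝓡-ax ⊖-def (s ∷ᵛ t ∷ᵛ []ᵛ)))

  ⊖-≺ : T ∣ Ξ ⊢ s ≺ t → T ∣ Ξ ⊢ s ⊖ t ≐ 𝟘
  ⊖-≺ {s = s} {t} = ⇒E (∧E₂ (𝓡-ax ⊖-def (s ∷ᵛ t ∷ᵛ []ᵛ)))

  -- Adding u ∸ t to either side gives u, so u ∸ t can be cancelled. For the left side this needs u
  -- ∸ t ≤ u, which follows from 0 ≤ t by adding u ∸ t.
  min-≽ : T ∣ Ξ ⊢ t ≼ u → T ∣ Ξ ⊢ min u t ≐ t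
  min-≽ {t = t} {u} t≼u =
    ⊕-cancelʳ (≐-trans (⊖-⊕ u⊖t≼u) (≐-trans (≐-sym (⊖-⊕ t≼u)) (𝓡-ax ⊕-comm ((u ⊖ t) ∷ᵛ t ∷ᵛ []ᵛ))))
    where
    u⊖t≼u = ≼-respʳ (≐-trans (𝓡-ax ⊕-comm (t ∷ᵛ (u ⊖ t) ∷ᵛ []ᵛ)) (⊖-⊕ t≼u))
                    (≼-respˡ (𝟘⊕ (u ⊖ t)) (⊕-mono-≼ 𝟘-least))

  -- If u < t then u ∸ t = 0, and u ∸ 0 = u. Otherwise antisymmetry gives t = u, and `min-≽`
  -- applies.
  min-≼ : T ∣ Ξ ⊢ u ≼ t → T ∣ Ξ ⊢ min u t ≐ u
  min-≼ {u = u} {t} u≼t = ∨E (≺-or-≽ u t)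
    (≐-trans (⊖-congʳ (⊖-≺ hyp₀))
             (≐-trans (≐-sym (𝓡-ax ⊕-identity ((u ⊖ 𝟘) ∷ᵛ []ᵛ))) (⊖-⊕ 𝟘-least)))
    (≐-trans (min-≽ hyp₀)
             (⇒E (𝓡-ax ≼-antisym (t ∷ᵛ u ∷ᵛ []ᵛ)) (∧I hyp₀ (weaken₁ u≼t))))

-- Induction up to a bound

∷ᵛ-η : (ρ : Sub L (suc m) n) → ∀ i → (ρ 0F ∷ᵛ (ρ ∘ suc)) i ≡ ρ i
∷ᵛ-η ρ zero    = refl
∷ᵛ-η ρ (suc i) = refl

∀-open : T ∣ Γ ⊢ ∀′ φ → T ∣ map wk Γ ⊢ φ
∀-open {φ = φ} d = cast (trans (lift-⟨⟩ _ (var 0F) φ) ([]-id (∷ᵛ-η var) φ))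
                        (∀E (instantiate d (var ∘ suc)) (var 0F))

⟪var0⟫ : (φ : Formula L (suc n)) → φ ⟪ var 0F ⟫ ≡ φ
⟪var0⟫ = []-id (∷ᵛ-η var)

module _ {𝕋 : TermClass L} {Ψ : FormulaClass L} {𝓐 : Theory L} where

  𝓐⊑𝔅 : 𝓐 ⊑ 𝔅 𝕋 Ψ 𝓐
  𝓐⊑𝔅 φ∈𝓐 = axiom-⊢ (axiom φ∈𝓐)

  module _ (𝓡⊑𝓐 : 𝓡 ⊑ 𝓐) (Ψ-subst : ClosedUnderSubstitution Ψ) where

    𝓡⊑𝔅 : 𝓡 ⊑ 𝔅 𝕋 Ψ 𝓐
    𝓡⊑𝔅 φ∈𝓡 = ⊢-mono 𝓐⊑𝔅 (𝓡⊑𝓐 φ∈𝓡)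

    open Arithmetic {T = 𝔅 𝕋 Ψ 𝓐} 𝓡⊑𝔅

    -- Common core of both kinds of flow. The induction axiom evaluates its formula at a term in
    -- which x₀ may occur, so t enters weakened by a dummy x₀. A term class is closed under
    -- substitution only up to provable equality, hence the representative `t′`.
    bounded-induction : {t : Term L n} {H : Formula L (suc n)} → H ∈ Ψ →
      ∃[ t′ ] (t′ ∈ 𝕋) × (𝓐 ⊢ wkᵗ t ≐ t′) →
      𝔅 𝕋 Ψ 𝓐 ∣ var 0F ≺ wkᵗ t ∷ [] ⊢ H ⇒ H ⟪ var 0F ⊕ 𝟙 ⟫ →
      𝔅 𝕋 Ψ 𝓐 ⊢ H ⟨ 𝟘 ⟩ ⇒ H ⟨ t ⟩
    bounded-induction {n} {t} {H} H∈Ψ (t′ , t′∈𝕋 , wkt≐t′) next =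
      ⇒I (≐-replace H var min-t (cast K-t′
        -- The conclusion of the axiom is quantified over x₀. The value of `t′` does not depend on
        -- it, so 0 is as good an instance as any.
        (∀E (⇒E (weaken₀ (axiom-⊢ (induction (Ψ-subst H∈Ψ _) t′∈𝕋)))
                (∧I initial (∀I (⇒I successive))))
            𝟘)))
      where
      K : Formula L (suc n)
      K = H ⟪ min (var 0F) (wkᵗ t) ⟫

      K-⟨⟩ : ∀ s → K ⟨ s ⟩ ≡ H ⟨ min s t ⟩
      K-⟨⟩ s = []-fuse (λ where
        zero    → cong (λ v → min s v) (wkᵗ-⟨⟩ s t)
        (suc i) → refl) H

      K-⟪⟫ : ∀ s → K ⟪ s ⟫ ≡ H ⟪ min s (wkᵗ t) ⟫
      K-⟪⟫ s = []-fuse (λ where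
        zero    → cong (λ v → min s v) (wkᵗ-∷ s (var ∘ suc) t)
        (suc i) → refl) H

      t₀ : Term L n
      t₀ = t′ [ 𝟘 ∷ᵛ var ]ᵗ

      K-t′ : K ⟪ t′ ⟫ ⟨ 𝟘 ⟩ ≡ H ⟨ min t₀ t ⟩
      K-t′ = trans ([]-fuse (λ where
        zero    → refl
        (suc i) → refl) K) (K-⟨⟩ t₀)

      -- Although x₀ may occur in `t′`, setting it to 0 in `wkᵗ t ≐ t′` gives t = t₀, so the minimum
      -- is t.
      min-t : {Ξ : List (Formula L n)} → 𝔅 𝕋 Ψ 𝓐 ∣ Ξ ⊢ min t₀ t ≐ t
      min-t = min-≽ (≼-reflexive (weaken₀ (⊢-mono 𝓐⊑𝔅
        (cast (cong (_≐ t₀) (wkᵗ-⟨⟩ 𝟘 t)) (instantiate wkt≐t′ (𝟘 ∷ᵛ var))))))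

      initial : 𝔅 𝕋 Ψ 𝓐 ∣ H ⟨ 𝟘 ⟩ ∷ [] ⊢ K ⟨ 𝟘 ⟩
      initial = cast (sym (K-⟨⟩ 𝟘)) (≐-replace H var (≐-sym (min-≼ 𝟘-least)) hyp₀)

      successive : {Ξ : List (Formula L (suc n))} → 𝔅 𝕋 Ψ 𝓐 ∣ K ∷ Ξ ⊢ K ⟪ var 0F ⊕ 𝟙 ⟫
      successive = cast (sym (K-⟪⟫ (var 0F ⊕ 𝟙))) (∨E (≺-or-≽ (var 0F) (wkᵗ t))
        -- Below t, discreteness gives x₀ + 1 ≤ t. The minimum therefore changes neither x₀ nor x₀ +
        -- 1, and `next` applies.
        (≐-replace H (var ∘ suc) (≐-sym (min-≼ (⊕𝟙-≼ hyp₀)))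
          (⇒E (weaken (∷⁺ʳ _ λ ()) next)
              (cast (⟪var0⟫ H)
                    (≐-replace H (var ∘ suc) (min-≼ (∧E₁ hyp₀)) (weaken₁ hyp₀)))))
        (≐-replace H (var ∘ suc)
          (≐-trans (min-≽ hyp₀) (≐-sym (min-≽
            (⇒E (𝓡-ax ≼-trans (wkᵗ t ∷ᵛ var 0F ∷ᵛ (var 0F ⊕ 𝟙) ∷ᵛ []ᵛ))
                (∧I hyp₀ (∧E₁ (≺-⊕𝟙 (var 0F))))))))
          (weaken₁ hyp₀)))

-- Blocks of bounded quantifiers

-- Reconciles two readings of a bound: as it stands in `within` under the whole of `ρ`, and as it
-- appears when the outer quantifiers are instantiated first and the innermost one afterwards.
bound-[] : (t : Term L m) (ρ : Sub L (suc m) n) →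
           wkᵗ t [ ρ ]ᵗ ≡ wkᵗ t [ lift (ρ ∘ suc) ]ᵗ [ ρ 0F ∷ᵛ var ]ᵗ
bound-[] t ρ = trans ([]ᵗ-fuse (λ _ → refl) t)
  (sym (trans (cong (_[ ρ 0F ∷ᵛ var ]ᵗ) (wkᵗ-lift (ρ ∘ suc) t)) (wkᵗ-⟨⟩ (ρ 0F) _)))

-- `ρ` treats u⃗ and x⃗ at once: its first `a` entries instantiate the block, and the rest acts on
-- the free variables. The recursion instantiates the outer quantifiers by `ρ ∘ suc` and then the
-- innermost one by `ρ 0F`.
∀≤*-elim : (p : Bounds L n a) {C : Formula L (a + n)} (ρ : Sub L (a + n) m) →
           T ∣ Γ ⊢ ∀≤* p C [ ρ ∘ (a ↑ʳ_) ] → T ∣ Γ ⊢ within p [ ρ ] → T ∣ Γ ⊢ C [ ρ ]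
∀≤*-elim []          ρ d e = d
∀≤*-elim (p ▷ t) {C} ρ d e =
  cast (trans (lift-⟨⟩ (ρ ∘ suc) (ρ 0F) C) ([]-cong (∷ᵛ-η ρ) C))
    (⇒E (∀E (∀≤*-elim p (ρ ∘ suc) d (cast ([]-fuse (λ _ → refl) (within p)) (∧E₁ e))) (ρ 0F))
        (cast (cong (ρ 0F ≼_) (bound-[] t ρ)) (∧E₂ e)))

∀≤*-intro : (q : Bounds L n b) {D : Formula L (b + n)} →
            T ∣ within q ∷ map (wk* b) Γ ⊢ D → T ∣ Γ ⊢ ∀≤* q D
-- For the empty block `within` is `⊥′ ⇒ ⊥′`, which `⇒I hyp₀` proves.
∀≤*-intro {Γ = Γ} [] d = cut (⇒I hyp₀) (castᶜ (cong (_ ∷_) (map-wk*-zero Γ)) d)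
∀≤*-intro {b = suc b} {Γ = Γ} (q ▷ t) d =
  ∀≤*-intro q (∀I (⇒I
    (cut (∧I (weaken₁ hyp₀) hyp₀)
         (weaken (∷⁺ʳ _ (xs⊆x∷xs _ _ ∘ xs⊆x∷xs _ _))
                 (castᶜ (cong (_ ∷_) (map-wk*-suc b Γ)) d)))))

∃≤*-intro : (q : Bounds L n a) {D : Formula L (a + n)} (ρ : Sub L (a + n) m) →
            T ∣ Γ ⊢ within q [ ρ ] → T ∣ Γ ⊢ D [ ρ ] → T ∣ Γ ⊢ ∃≤* q D [ ρ ∘ (a ↑ʳ_) ]
∃≤*-intro []          ρ e d = d
∃≤*-intro (q ▷ t) {D} ρ e d =
  ∃≤*-intro q (ρ ∘ suc) (cast ([]-fuse (λ _ → refl) (within q)) (∧E₁ e))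
    (∃I (ρ 0F) (∧I (cast (cong (ρ 0F ≼_) (bound-[] t ρ)) (∧E₂ e))
                   (cast (sym (trans (lift-⟨⟩ (ρ ∘ suc) (ρ 0F) D) ([]-cong (∷ᵛ-η ρ) D))) d)))

∃≤*-elim : (p : Bounds L n a) {C : Formula L (a + n)} →
           T ∣ Γ ⊢ ∃≤* p C → T ∣ within p ∧ C ∷ map (wk* a) Γ ⊢ wk* a χ → T ∣ Γ ⊢ χ
∃≤*-elim {Γ = Γ} {χ = χ} [] d e =
  cut (∧I (⇒I hyp₀) d)
      (cast ([]-id (λ _ → refl) χ) (castᶜ (cong (_ ∷_) (map-wk*-zero Γ)) e))
∃≤*-elim {a = suc a} {Γ = Γ} {χ = χ} (p ▷ t) d e =
  ∃≤*-elim p d (∃E (∧E₂ hyp₀)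
    (cut (∧I (∧I (∧E₁ (weaken₁ hyp₀)) (∧E₁ hyp₀)) (∧E₂ hyp₀))
         (weaken (∷⁺ʳ _ (xs⊆x∷xs _ _ ∘ xs⊆x∷xs _ _))
                 (cast (wk*-suc a χ) (castᶜ (cong (_ ∷_) (map-wk*-suc a Γ)) e)))))

-- Closure of the hierarchy under substitution

lift* : (a : ℕ) → Sub L m n → Sub L (a + m) (a + n)
lift* zero    σ = σ
lift* (suc a) σ = lift (lift* a σ)

_[_]ᵇ : Bounds L m a → Sub L m n → Bounds L n a
[]      [ σ ]ᵇ = []
(p ▷ t) [ σ ]ᵇ = (p [ σ ]ᵇ) ▷ (t [ lift* _ σ ]ᵗ)

∀≤*-[] : (p : Bounds L m a) (φ : Formula L (a + m)) (σ : Sub L m n) →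
         ∀≤* p φ [ σ ] ≡ ∀≤* (p [ σ ]ᵇ) (φ [ lift* a σ ])
∀≤*-[] []      φ σ = refl
∀≤*-[] (p ▷ t) φ σ = trans (∀≤*-[] p (∀≤ t φ) σ)
  (cong (λ s → ∀≤* (p [ σ ]ᵇ) (∀′ (var 0F ≼ s ⇒ φ [ lift (lift* _ σ) ]))) (wkᵗ-lift (lift* _ σ) t))

∃≤*-[] : (p : Bounds L m a) (φ : Formula L (a + m)) (σ : Sub L m n) →
         ∃≤* p φ [ σ ] ≡ ∃≤* (p [ σ ]ᵇ) (φ [ lift* a σ ])
∃≤*-[] []      φ σ = refl
∃≤*-[] (p ▷ t) φ σ = trans (∃≤*-[] p (∃≤ t φ) σ)
  (cong (λ s → ∃≤* (p [ σ ]ᵇ) (∃′ (var 0F ≼ s ∧ φ [ lift (lift* _ σ) ]))) (wkᵗ-lift (lift* _ σ) t))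

module _ {Φ : FormulaClass L} (Φ-subst : ClosedUnderSubstitution Φ) where

  mutual
    -- Keeps H(min(u , t)) in the class for which induction is available. Substitution acts on the
    -- bounds and on the matrix of a block, leaving the quantifier prefix intact.
    Π-subst : (k : ℕ) → ClosedUnderSubstitution (Π[ k ] Φ)
    Π-subst zero    = Φ-subst
    Π-subst (suc k) (block p {φ} φ∈Σ) σ =
      subst (∀Block (Σ[ k ] Φ)) (sym (∀≤*-[] p φ σ)) (block (p [ σ ]ᵇ) (Σ-subst k φ∈Σ (lift* _ σ)))

    Σ-subst : (k : ℕ) → ClosedUnderSubstitution (Σ[ k ] Φ)
    Σ-subst zero    = Φ-subst
    Σ-subst (suc k) (block p {φ} φ∈Π) σ =
      subst (∃Block (Π[ k ] Φ)) (sym (∃≤*-[] p φ σ)) (block (p [ σ ]ᵇ) (Π-subst k φ∈Π (lift* _ σ)))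

-- Deterministic reductions as implications

module _ {Φ : FormulaClass L} {𝓑 : Theory L} (𝓡⊑𝓑 : 𝓡 ⊑ 𝓑) where

  private
    fromᴿ : {Γ : List (Formula L n)} → 𝓡 ⊢ φ → 𝓑 ∣ Γ ⊢ φ
    fromᴿ d = weaken₀ (⊢-mono 𝓡⊑𝓑 d)

    -- `plug` fixes x⃗, so a formula in x⃗ alone is merely weakened by it. This puts a weakened
    -- block into the form that the block rules expect.
    plug-wk* : (F : Vector (Term L (b + n)) a) (φ : Formula L n) →
               wk* b φ ≡ φ [ (F ++ᵛ (λ i → var (b ↑ʳ i))) ∘ (a ↑ʳ_) ]
    plug-wk* F = []-cong (λ i → sym (lookup-++ʳ F _ i))

  mutual
    -- For v⃗ ≤ q⃗ the terms F(v⃗) lie within p⃗, so the block of A may be instantiated at them.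
    -- This yields C′, the reduction one level down leads to D′, and D′ together with v⃗ ≤ q⃗ yields
    -- D.
    Reduceᴾ⇒ : {Γ : List (Formula L n)} {F : TermSeq L n k} {A B : Formula L n} →
               Reduceᴾ Φ 𝓑 Γ F A B → 𝓑 ∣ Γ ⊢ A ⇒ B
    Reduceᴾ⇒ (base _ _ d) = d
    Reduceᴾ⇒ (step p q {C = C} {F = F} _ _ inBounds C′⇔ D′⇔ r) =
      ⇒I (∀≤*-intro q
        (⇒E (⇒E (∧E₁ (fromᴿ D′⇔))
                (⇒E (weaken₁ (weaken₁ (Reduceˢ⇒ r)))
                    (⇒E (∧E₂ (fromᴿ C′⇔)) (⇒I (weaken₁ (∀≤*-elim p _
                      (cast (plug-wk* F (∀≤* p C)) (weaken₁ hyp₀))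
                      (⇒E (weaken₁ (weaken₁ inBounds)) hyp₀)))))))
            hyp₀))

    -- Dually, u⃗ is taken from A and F(u⃗) serves as witness for B: u⃗ ≤ p⃗ and C give C′, hence
    -- D′, whose second conjunct is D at F(u⃗).
    Reduceˢ⇒ : {Γ : List (Formula L n)} {F : TermSeq L n k} {A B : Formula L n} →
               Reduceˢ Φ 𝓑 Γ F A B → 𝓑 ∣ Γ ⊢ A ⇒ B
    Reduceˢ⇒ (base _ _ d) = d
    Reduceˢ⇒ (step p q {D = D} {D′ = D′} {F = F} _ _ inBounds C′⇔ D′⇔ r) =
      ⇒I (∃≤*-elim p hyp₀
        (cast (sym (plug-wk* F (∃≤* q D)))
          (∃≤*-intro q _ (⇒E (weaken₁ (weaken₁ inBounds)) (∧E₁ hyp₀))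
            (∧E₂ (⇒E (∧E₁ (fromᴿ D′⇔))
              (⇒E (weaken₁ (weaken₁ (Reduceᴾ⇒ r))) (⇒E (∧E₂ (fromᴿ C′⇔)) hyp₀)))))))

-- Chaining the implications of a flow

theorem2p32 : (L : Language) (𝓐 𝓑 : Theory L) →
    ({n : ℕ} {φ : Formula L n} → φ ∈ 𝓐 → QuantifierFree φ) →
    𝓡 ⊑ 𝓐 →
    𝓡 ⊑ 𝓑 →
    ( (Φ : FormulaClass L) →
    ({n : ℕ} {φ : Formula L n} → φ ∈ Φ → Bounded φ) →
    ContainsQF Φ →
    ClosedUnderBoolean Φ →
    ClosedUnderSubstitution Φ →
    ClosedUnderSubformulas Φ →
    IsTermIdeal 𝓐 𝕋all →
    (k n : ℕ) (Γ Δ : List (Formula L n)) →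
    All (λ φ → φ ∈ Π[ k ] Φ) Γ →
    All (λ φ → φ ∈ Π[ k ] Φ) Δ →
    FlowBetween (Π[ k ] Φ) (DetFlow k Φ 𝓑) Γ Δ →
    𝓑 ⊑ 𝔅 𝕋all (Π[ k ] Φ) 𝓐 →
    𝔅 𝕋all (Π[ k ] Φ) 𝓐 ⊢ Γ ⟹ Δ )
    ×
    ( (𝕋 : TermClass L) (Π : FormulaClass L) →
    IsTermIdeal 𝓐 𝕋 →
    ({n : ℕ} {φ : Formula L n} → φ ∈ Π → Bounded φ) →
    IsπClass Π →
    (n : ℕ) (Γ Δ : List (Formula L n)) →
    All (λ φ → φ ∈ Π) Γ →
    All (λ φ → φ ∈ Π) Δ →
    FlowBetween Π (NondetFlow 𝕋 Π 𝓑) Γ Δ →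
    𝓑 ⊑ 𝔅 𝕋 Π 𝓐 →
    𝔅 𝕋 Π 𝓐 ⊢ Γ ⟹ Δ )
theorem2p32 L 𝓐 𝓑 _ 𝓡⊑𝓐 𝓡⊑𝓑 = deterministic , nondeterministic
  where
  deterministic : _
  deterministic Φ _ _ _ Φ-subst _ _ k n Γ Δ _ _ (A , B , _ , _ , A⇔⋀Γ , B⇔⋁Δ , flow) 𝓑⊑𝔅 =
    -- The chain is ⋀Γ ⇒ A ⇒ H(0) ⇒ H(t) ⇒ B ⇒ ⋁Δ; of each equivalence only the direction along it
    -- is taken.
    ⇒-trans (∧E₂ (fromᴿ A⇔⋀Γ))
    (⇒-trans (⊢-mono 𝓑⊑𝔅 (Reduceᴾ⇒ 𝓡⊑𝓑 (proj₂ start)))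
    -- Every term belongs to `𝕋all`, so the weakened t represents itself.
    (⇒-trans (bounded-induction 𝓡⊑𝓐 (Π-subst Φ-subst k) H∈Π (_ , tt , ≐I)
               (⊢-mono 𝓑⊑𝔅 (Reduceᴾ⇒ 𝓡⊑𝓑 next)))
    (⇒-trans (⊢-mono 𝓑⊑𝔅 (Reduceᴾ⇒ 𝓡⊑𝓑 (proj₁ end)))
             (∧E₁ (fromᴿ B⇔⋁Δ)))))
    where
    open DetFlow flow
    fromᴿ : {φ : Formula L n} → 𝓡 ⊢ φ → 𝔅 𝕋all (Π[ k ] Φ) 𝓐 ⊢ φ
    fromᴿ d = ⊢-mono 𝓑⊑𝔅 (⊢-mono 𝓡⊑𝓑 d)

  nondeterministic : _
  nondeterministic 𝕋 Π 𝕋-ideal _ Π-class n Γ Δ _ _ (A , B , _ , _ , A⇔⋀Γ , B⇔⋁Δ , flow) 𝓑⊑𝔅 =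
    ⇒-trans (∧E₂ (fromᴿ A⇔⋀Γ))
    (⇒-trans (∧E₂ (⊢-mono 𝓑⊑𝔅 start))
    (⇒-trans (bounded-induction 𝓡⊑𝓐 (IsπClass.substitution Π-class) H∈Π
               -- Weakening t is a renaming of variables, so closure of `𝕋` under substitution
               -- supplies the representative.
               (IsTermSet.substitution (IsTermIdeal.isTermSet 𝕋-ideal) t∈𝕋 (var ∘ suc))
               (⊢-mono 𝓑⊑𝔅 (⇒E (weaken₁ (∀-open next)) hyp₀)))
    (⇒-trans (∧E₁ (⊢-mono 𝓑⊑𝔅 end))
             (∧E₁ (fromᴿ B⇔⋁Δ)))))
    where
    open NondetFlow flow
    fromᴿ : {φ : Formula L n} → 𝓡 ⊢ φ → 𝔅 𝕋 Π 𝓐 ⊢ φ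
    fromᴿ d = ⊢-mono 𝓑⊑𝔅 (⊢-mono 𝓡⊑𝓑 d)
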